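{- For every countable graph $G$ not containing $K_\omega$ as a subgraph there exists a countable rigid graph $G'$ containing $G$ as an induced subgraph.
   Context: All graphs are simple, undirected and loopless. A homomorphism is a vertex map preserving edges. A graph $G'$ is rigid if the identity map is its only homomorphism $G' \to G'$. $K_\omega$ denotes the countably infinite complete graph. -}

module Defs where

open import Data.Nat using (ℕ)
open import Data.Product using (Σ; _×_)
open import Function.Bundles using (_↣_; _⇔_)
open import Function.Definitions using (Injective)
open import Level using (0ℓ)
open import Relation.Binary.Core using (Rel; _Preserves_⟶_)
open import Relation.Binary.Definitions using (Symmetric; Irreflexive)
open import Relation.Binary.PropositionalEquality using (_≡_; _≢_; ≢-sym)

-- Adjacency is a relation: u and v are adjacent when u ~ v is inhabited.
-- No notion below distinguishes inhabitants of u ~ v, so no multiplicity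
-- of edges is being recorded; decidability of _~_ is not assumed.
record Graph : Set₁ where
  infix 4 _~_
  field
    Vertex   : Set
    _~_      : Rel Vertex 0ℓ
    ~-sym    : Symmetric _~_
    ~-irrefl : Irreflexive _≡_ _~_

open Graph using (Vertex)

Adj : (G : Graph) → Rel (Vertex G) 0ℓ
Adj = Graph._~_

-- Finite (possibly empty) or countably infinite.
Countable : Graph → Set
Countable G = Vertex G ↣ ℕ

IsHomomorphism : (G H : Graph) → (Vertex G → Vertex H) → Set
IsHomomorphism G H f = f Preserves Adj G ⟶ Adj H

-- Equality with the identity is pointwise: function extensionality is not
-- available.
Rigid : Graph → Set
Rigid G = (f : Vertex G → Vertex G) → IsHomomorphism G G f → ∀ v → f v ≡ v

ContainsSubgraph : (G H : Graph) → Set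
ContainsSubgraph G H =
  Σ (Vertex H → Vertex G) λ f → Injective _≡_ _≡_ f × IsHomomorphism H G f

ContainsInduced : (G H : Graph) → Set
ContainsInduced G H =
  Σ (Vertex H → Vertex G) λ f →
    Injective _≡_ _≡_ f × (∀ u v → Adj H u v ⇔ Adj G (f u) (f v))

Kω : Graph
Kω = record
  { Vertex   = ℕ
  ; _~_      = _≢_
  ; ~-sym    = ≢-sym
  ; ~-irrefl = λ i≡j i≢j → i≢j i≡j
  }

{-# OPTIONS --safe #-}
-- Let T be the tree of finite cliques of G, with comparable cliques adjacent.  In
-- a homomorphism from the join K_m ∨ T to K_q ∨ T or K_q ∨ G with m > q, one can
-- copy the answers back as the next clique played, and so find K_ω in G.
--
-- Take a finite rigid graph F and make each of its vertices a root, joined to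
-- disjoint copies of K_n ∨ T for all n.  The neighbourhood of any vertex outside F
-- maps to some K_q ∨ T or K_q ∨ G, so a root is never sent outside F, and F is
-- fixed pointwise.  A ray is attached to F so that each ray vertex is the only
-- common neighbour of its predecessor and two vertices of F; hence the ray is
-- fixed.  Finally every vertex of G and of the copies of K_n ∨ T is the only
-- common neighbour of its own pair of ray vertices, so it is fixed as well.
module Submission where

open import Defs
open import Data.Bool using (Bool; true; false; T)
open import Data.Bool.Properties using (T?)
open import Data.Empty using (⊥)
open import Data.Fin using (Fin; zero; suc; toℕ; fromℕ<; _↑ˡ_; _↑ʳ_; splitAt)
open import Data.Fin.Patterns
open import Data.Fin.Properties using (_≟_; all?; injective⇒≤; fromℕ<-injective; toℕ-injective; toℕ<n; ↑ˡ-injective; ↑ʳ-injective; splitAt-↑ˡ; splitAt-↑ʳ; suc-injective)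
open import Data.List using (List; []; _∷_; length; lookup; mapMaybe; tabulate)
import Data.List as List
open import Data.List.Membership.Propositional using (_∈_)
open import Data.List.Membership.Propositional.Properties using (∈-lookup)
open import Data.List.Properties using (length-map; length-tabulate; map-injective; ∷-injective)
open import Data.List.Relation.Unary.All as All using (All; []; _∷_)
import Data.List.Relation.Unary.All.Properties as All
open import Data.List.Relation.Unary.AllPairs as AllPairs using (AllPairs; []; _∷_)
import Data.List.Relation.Unary.AllPairs.Properties as AllPairs
open import Data.List.Relation.Unary.Any using (here; there)
open import Data.Nat using (ℕ; zero; suc; _+_; _*_; _≤_; _<_; _≤?_; s≤s; s≤s⁻¹)
open import Data.Nat.Properties as ℕ using (≤-refl; ≤-trans; m≤n⇒m≤1+n)
open import Data.Product using (Σ; ∃; _×_; _,_; proj₁; proj₂)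
open import Data.Sum using (_⊎_; inj₁; inj₂; isInj₁; isInj₂; swap)
open import Data.Unit using (⊤; tt)
open import Data.Vec as Vec using (Vec; []; _∷_)
open import Function using (_∘_; _on_)
open import Function.Bundles using (Injection; mk⇔; mk↣)
open import Level using (0ℓ)
open import Relation.Binary.Core using (Rel)
open import Relation.Binary.Definitions using (tri<; tri≈; tri>)
open import Relation.Binary.PropositionalEquality using (_≡_; _≢_; refl; sym; trans; cong; subst; subst₂; ≢-sym)
open import Relation.Nullary using (¬_; Dec; yes; no; contradiction)
open import Relation.Nullary.Decidable using (_→-dec_; _×-dec_; _⊎-dec_; ¬?; from-yes)

-- A finite rigid graph

pattern ○ = false
pattern ● = true

-- Two strips of triangles, 012, 023, 234 and 456, 567, share the vertex 4 and are linked further by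
-- the edges 15 and 07.
adjacency : Vec (Vec Bool 8) 8
adjacency =
  (○ ∷ ● ∷ ● ∷ ● ∷ ○ ∷ ○ ∷ ○ ∷ ● ∷ []) ∷
  (● ∷ ○ ∷ ● ∷ ○ ∷ ○ ∷ ● ∷ ○ ∷ ○ ∷ []) ∷
  (● ∷ ● ∷ ○ ∷ ● ∷ ● ∷ ○ ∷ ○ ∷ ○ ∷ []) ∷
  (● ∷ ○ ∷ ● ∷ ○ ∷ ● ∷ ○ ∷ ○ ∷ ○ ∷ []) ∷
  (○ ∷ ○ ∷ ● ∷ ● ∷ ○ ∷ ● ∷ ● ∷ ○ ∷ []) ∷
  (○ ∷ ● ∷ ○ ∷ ○ ∷ ● ∷ ○ ∷ ● ∷ ● ∷ []) ∷
  (○ ∷ ○ ∷ ○ ∷ ○ ∷ ● ∷ ● ∷ ○ ∷ ● ∷ []) ∷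
  (● ∷ ○ ∷ ○ ∷ ○ ∷ ○ ∷ ● ∷ ● ∷ ○ ∷ []) ∷ []

Edge : Rel (Fin 8) 0ℓ
Edge a b = T (Vec.lookup (Vec.lookup adjacency a) b)

edge? : ∀ a b → Dec (Edge a b)
edge? a b = T? _

Edge-sym : ∀ a b → Edge a b → Edge b a
Edge-sym = from-yes (all? λ a → all? λ b → edge? a b →-dec edge? b a)

Edge-irrefl : ∀ a → ¬ Edge a a
Edge-irrefl = from-yes (all? λ a → ¬? (edge? a a))

-- The edge hypotheses are interleaved with the quantifiers so that the decision
-- procedure backtracks early instead of enumerating all 8⁸ maps.
Edge-rigid′ : ∀ a₀ a₁ → Edge a₀ a₁ → ∀ a₂ → Edge a₀ a₂ → Edge a₁ a₂ →
  ∀ a₃ → Edge a₀ a₃ → Edge a₂ a₃ → ∀ a₄ → Edge a₂ a₄ → Edge a₃ a₄ →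
  ∀ a₅ → Edge a₁ a₅ → Edge a₄ a₅ → ∀ a₆ → Edge a₄ a₆ → Edge a₅ a₆ →
  ∀ a₇ → Edge a₀ a₇ → Edge a₅ a₇ → Edge a₆ a₇ →
  (a₀ ≡ 0F × a₁ ≡ 1F × a₂ ≡ 2F × a₃ ≡ 3F) × (a₄ ≡ 4F × a₅ ≡ 5F × a₆ ≡ 6F × a₇ ≡ 7F)
Edge-rigid′ = from-yes (
  all? λ a₀ → all? λ a₁ → edge? a₀ a₁ →-dec
  all? λ a₂ → edge? a₀ a₂ →-dec edge? a₁ a₂ →-dec
  all? λ a₃ → edge? a₀ a₃ →-dec edge? a₂ a₃ →-dec
  all? λ a₄ → edge? a₂ a₄ →-dec edge? a₃ a₄ →-dec
  all? λ a₅ → edge? a₁ a₅ →-dec edge? a₄ a₅ →-dec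
  all? λ a₆ → edge? a₄ a₆ →-dec edge? a₅ a₆ →-dec
  all? λ a₇ → edge? a₀ a₇ →-dec edge? a₅ a₇ →-dec edge? a₆ a₇ →-dec
  ((a₀ ≟ 0F ×-dec a₁ ≟ 1F ×-dec a₂ ≟ 2F ×-dec a₃ ≟ 3F) ×-dec
   (a₄ ≟ 4F ×-dec a₅ ≟ 5F ×-dec a₆ ≟ 6F ×-dec a₇ ≟ 7F)))

Edge-rigid : (f : Fin 8 → Fin 8) → (∀ a b → Edge a b → Edge (f a) (f b)) → ∀ a → f a ≡ a
Edge-rigid f hom = λ where
    0F → e₀
    1F → e₁
    2F → e₂
    3F → e₃
    4F → e₄
    5F → e₅
    6F → e₆
    7F → e₇
  where
  images = Edge-rigid′ (f 0F) (f 1F) (hom 0F 1F tt) (f 2F) (hom 0F 2F tt) (hom 1F 2F tt)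
    (f 3F) (hom 0F 3F tt) (hom 2F 3F tt) (f 4F) (hom 2F 4F tt) (hom 3F 4F tt)
    (f 5F) (hom 1F 5F tt) (hom 4F 5F tt) (f 6F) (hom 4F 6F tt) (hom 5F 6F tt)
    (f 7F) (hom 0F 7F tt) (hom 5F 7F tt) (hom 6F 7F tt)
  e₀ = proj₁ (proj₁ images)
  e₁ = proj₁ (proj₂ (proj₁ images))
  e₂ = proj₁ (proj₂ (proj₂ (proj₁ images)))
  e₃ = proj₂ (proj₂ (proj₂ (proj₁ images)))
  e₄ = proj₁ (proj₂ images)
  e₅ = proj₁ (proj₂ (proj₂ images))
  e₆ = proj₁ (proj₂ (proj₂ (proj₂ images)))
  e₇ = proj₂ (proj₂ (proj₂ (proj₂ images)))

-- Counting in joins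

↑ˡ≢↑ʳ : ∀ {m n} (i : Fin m) (j : Fin n) → i ↑ˡ n ≢ m ↑ʳ j
↑ˡ≢↑ʳ {m} {n} i j eq
  with () ← trans (sym (splitAt-↑ˡ m i n)) (trans (cong (splitAt m) eq) (splitAt-↑ʳ m n j))

lookup-injective : ∀ {A : Set} {xs : List A} → AllPairs _≢_ xs →
  ∀ i j → lookup xs i ≡ lookup xs j → i ≡ j
lookup-injective (_ ∷ _)  zero    zero    _  = refl
lookup-injective (p ∷ _)  zero    (suc j) eq = contradiction eq (All.lookup p (∈-lookup j))
lookup-injective (p ∷ _)  (suc i) zero    eq = contradiction (sym eq) (All.lookup p (∈-lookup i))
lookup-injective (_ ∷ ps) (suc i) (suc j) eq = cong suc (lookup-injective ps i j eq)

-- Pigeonhole: sending a position to its entry injects the positions into `Fin q`.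
distinct⇒length≤ : ∀ {q} {xs : List ℕ} → AllPairs _≢_ xs → All (_< q) xs → length xs ≤ q
distinct⇒length≤ distinct bounded = injective⇒≤ {f = λ i → fromℕ< (All.lookup bounded (∈-lookup i))}
  λ {i} {j} eq → lookup-injective distinct i j (fromℕ<-injective _ _ _ _ eq)

lefts : {A B : Set} → List (A ⊎ B) → List A
lefts = mapMaybe isInj₁

rights : {A B : Set} → List (A ⊎ B) → List B
rights = mapMaybe isInj₂

length-lefts-rights : {A B : Set} (xs : List (A ⊎ B)) →
  length xs ≡ length (lefts xs) + length (rights xs)
length-lefts-rights []            = refl
length-lefts-rights (inj₁ _ ∷ xs) = cong suc (length-lefts-rights xs)
length-lefts-rights (inj₂ _ ∷ xs) = trans (cong suc (length-lefts-rights xs))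
  (sym (ℕ.+-suc (length (lefts xs)) _))

module _ {A B : Set} where

  -- Adjacency in the graph join of the complete graph on `A` with `(B, R)`.
  Join : Rel B 0ℓ → Rel (A ⊎ B) 0ℓ
  Join R (inj₁ a) (inj₁ b) = a ≢ b
  Join R (inj₂ a) (inj₂ b) = R a b
  Join R _        _        = ⊤

  module _ {R : Rel B 0ℓ} where

    lefts-All : ∀ {a} xs → All (Join R (inj₁ a)) xs → All (a ≢_) (lefts xs)
    lefts-All []            []       = []
    lefts-All (inj₁ _ ∷ xs) (p ∷ ps) = p ∷ lefts-All xs ps
    lefts-All (inj₂ _ ∷ xs) (_ ∷ ps) = lefts-All xs ps

    rights-All : ∀ {b} xs → All (Join R (inj₂ b)) xs → All (R b) (rights xs)
    rights-All []            []       = []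
    rights-All (inj₁ _ ∷ xs) (_ ∷ ps) = rights-All xs ps
    rights-All (inj₂ _ ∷ xs) (p ∷ ps) = p ∷ rights-All xs ps

    lefts-AllPairs : ∀ xs → AllPairs (Join R) xs → AllPairs _≢_ (lefts xs)
    lefts-AllPairs []            []       = []
    lefts-AllPairs (inj₁ _ ∷ xs) (p ∷ ps) = lefts-All xs p ∷ lefts-AllPairs xs ps
    lefts-AllPairs (inj₂ _ ∷ xs) (_ ∷ ps) = lefts-AllPairs xs ps

    rights-AllPairs : ∀ xs → AllPairs (Join R) xs → AllPairs R (rights xs)
    rights-AllPairs []            []       = []
    rights-AllPairs (inj₁ _ ∷ xs) (_ ∷ ps) = rights-AllPairs xs ps
    rights-AllPairs (inj₂ _ ∷ xs) (p ∷ ps) = rights-All xs p ∷ rights-AllPairs xs ps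

-- A clique of the join uses each vertex of K_q at most once.
lefts-length≤ : ∀ {q} {B : Set} {R : Rel B 0ℓ} (xs : List (Fin q ⊎ B)) →
  AllPairs (Join R) xs → length (lefts xs) ≤ q
lefts-length≤ {R = R} xs ps = subst (_≤ _) (length-map toℕ (lefts xs))
  (distinct⇒length≤ (AllPairs.map⁺ (AllPairs.map (_∘ toℕ-injective) (lefts-AllPairs {R = R} xs ps)))
    (All.map⁺ (All.universal toℕ<n (lefts xs))))

-- Cliques as lists, newest vertex first

module _ {A : Set} where

  infix 4 _⊑_

  -- The suffix order; since lists grow at the head, a suffix is an earlier stage of the same
  -- clique.
  data _⊑_ (u : List A) : List A → Set where
    ⊑-refl : u ⊑ u
    ⊑-step : ∀ {x w} → u ⊑ w → u ⊑ x ∷ w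

  ⊑-trans : ∀ {u v w} → u ⊑ v → v ⊑ w → u ⊑ w
  ⊑-trans p ⊑-refl     = p
  ⊑-trans p (⊑-step q) = ⊑-step (⊑-trans p q)

  []⊑ : ∀ w → [] ⊑ w
  []⊑ []      = ⊑-refl
  []⊑ (_ ∷ w) = ⊑-step ([]⊑ w)

  ⊑-tail : ∀ {x u w} → x ∷ u ⊑ w → u ⊑ w
  ⊑-tail p = ⊑-trans (⊑-step ⊑-refl) p

  ⊑-length : ∀ {u w} → u ⊑ w → length u ≤ length w
  ⊑-length ⊑-refl     = ≤-refl
  ⊑-length (⊑-step p) = m≤n⇒m≤1+n (⊑-length p)

  -- Takes the entry of `w` just in front of the suffix `u`; this is the next vertex that the
  -- copycat plays.
  ⊑-extend : ∀ {u w} → u ⊑ w → length u < length w → ∃ λ x → x ∷ u ⊑ w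
  ⊑-extend ⊑-refl              lt = contradiction lt (ℕ.<-irrefl refl)
  ⊑-extend (⊑-step {x} ⊑-refl) _  = x , ⊑-refl
  ⊑-extend (⊑-step (⊑-step p)) _  =
    let y , q = ⊑-extend (⊑-step p) (s≤s (⊑-length p)) in y , ⊑-step q

  ⊑-AllPairs : ∀ {R : Rel A 0ℓ} {u w} → u ⊑ w → AllPairs R w → AllPairs R u
  ⊑-AllPairs ⊑-refl     ps       = ps
  ⊑-AllPairs (⊑-step q) (_ ∷ ps) = ⊑-AllPairs q ps

  -- For lists comparable under `_⊑_`, being distinct amounts to having distinct lengths; in this
  -- form cliques can be counted by their lengths.
  Comparable : Rel (List A) 0ℓ
  Comparable u w = (u ⊑ w ⊎ w ⊑ u) × length u ≢ length w

  Comparable-sym : ∀ {u w} → Comparable u w → Comparable w u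
  Comparable-sym (p , q) = swap p , ≢-sym q

-- Trackers and the copycat strategy

module _ (G : Graph) where

  open Graph G renaming (Vertex to V)

  Clique : List V → Set
  Clique = AllPairs _~_

  -- A coherent way of reading a clique of V off a clique of Z, losing at most
  -- one element.
  record Tracker (Z : Set) (R : Rel Z 0ℓ) : Set where
    field
      track        : List Z → List V
      track-clique : ∀ {zs} → AllPairs R zs → Clique (track zs)
      track-extend : ∀ {z zs} → AllPairs R (z ∷ zs) → track zs ⊑ track (z ∷ zs)
      track-length : ∀ {zs} → AllPairs R zs → length zs ≤ suc (length (track zs))

  trackVertices : Tracker V _~_
  trackVertices = record
    { track        = λ zs → zs
    ; track-clique = λ ps → ps
    ; track-extend = λ _ → ⊑-step ⊑-refl
    ; track-length = λ _ → ℕ.n≤1+n _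
    }

  CliqueList : Set
  CliqueList = Σ (List V) Clique

  -- A tie keeps the older list, so the value changes only to a strictly longer clique. The default
  -- is the empty clique, a suffix of every other.
  longest : List CliqueList → CliqueList
  longest [] = [] , []
  longest (z ∷ zs) with length (proj₁ z) ≤? length (proj₁ (longest zs))
  ... | yes _ = longest zs
  ... | no  _ = z

  _≬_ : Rel CliqueList 0ℓ
  _≬_ = Comparable on proj₁

  longest-comparable : ∀ z zs → All (z ≬_) zs →
    proj₁ z ⊑ proj₁ (longest zs) ⊎ proj₁ (longest zs) ⊑ proj₁ z
  longest-comparable z [] [] = inj₂ ([]⊑ _)
  longest-comparable z (y ∷ ys) (p ∷ ps) with length (proj₁ y) ≤? length (proj₁ (longest ys))
  ... | yes _ = longest-comparable z ys ps
  ... | no  _ = proj₁ p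

  -- A strictly longer list that is comparable with the current longest one can only extend it.
  longest-extend : ∀ z zs → AllPairs _≬_ (z ∷ zs) → proj₁ (longest zs) ⊑ proj₁ (longest (z ∷ zs))
  longest-extend z zs (p ∷ _) with length (proj₁ z) ≤? length (proj₁ (longest zs)) | longest-comparable z zs p
  ... | yes _ | _      = ⊑-refl
  ... | no  _ | inj₂ q = q
  ... | no ¬q | inj₁ q = contradiction (⊑-length q) ¬q

  longest-bounds : ∀ zs → AllPairs _≬_ zs →
    All (λ z → length (proj₁ z) < suc (length (proj₁ (longest zs)))) zs
  longest-bounds [] [] = []
  longest-bounds (z ∷ zs) ps@(_ ∷ ps′) = bound-head ∷
    All.map (λ lt → ≤-trans lt (s≤s (⊑-length (longest-extend z zs ps)))) (longest-bounds zs ps′)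
    where
    bound-head : length (proj₁ z) < suc (length (proj₁ (longest (z ∷ zs))))
    bound-head with length (proj₁ z) ≤? length (proj₁ (longest zs))
    ... | yes q = s≤s q
    ... | no  _ = ≤-refl

  -- Pairwise comparable cliques have distinct lengths, ranging from 0 to that of the longest; the
  -- possible length 0 accounts for the one element lost.
  trackLists : Tracker CliqueList _≬_
  trackLists = record
    { track        = proj₁ ∘ longest
    ; track-clique = λ {zs} _ → proj₂ (longest zs)
    ; track-extend = longest-extend _ _
    ; track-length = λ {zs} ps → subst (_≤ suc (length (proj₁ (longest zs)))) (length-map (length ∘ proj₁) zs)
        (distinct⇒length≤ (AllPairs.map⁺ (AllPairs.map proj₂ ps)) (All.map⁺ (longest-bounds zs ps)))
    }

  -- A map from the join of K_{q+1} with the tree of cliques of G to the join of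
  -- K_q with Z.  At most q answers lie in K_q, so the clique read off the
  -- answers to u and its suffixes is always longer than u; playing the next
  -- vertex of that clique keeps u a suffix of it for ever.
  module CopyCat {q} {Z : Set} {R : Rel Z 0ℓ} (tracker : Tracker Z R)
    (wait : Fin (suc q) → Fin q ⊎ Z) (play : ∀ u → Clique u → Fin q ⊎ Z)
    (wait-wait : ∀ {i j} → i ≢ j → Join R (wait i) (wait j))
    (play-wait : ∀ {u} c i → Join R (play u c) (wait i))
    (play-play : ∀ {u w} c d → Comparable w u → Join R (play w d) (play u c)) where

    open Tracker tracker

    -- The images of one clique of the source: all `suc q` waiting vertices, together with `u` and
    -- all its suffixes, the empty one included.
    answers : ∀ u → Clique u → List (Fin q ⊎ Z)
    answers []      []       = play [] [] ∷ tabulate wait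
    answers (x ∷ u) (p ∷ ps) = play (x ∷ u) (p ∷ ps) ∷ answers u ps

    answers-length : ∀ u c → length (answers u c) ≡ suc (suc (length u)) + q
    answers-length []      []       = cong suc (length-tabulate wait)
    answers-length (x ∷ u) (p ∷ ps) = cong suc (answers-length u ps)

    answers-All : ∀ {w} d u c → u ⊑ w → length u < length w → All (Join R (play w d)) (answers u c)
    answers-All d []      []       p lt =
      play-play [] d (inj₂ p , ≢-sym (ℕ.<⇒≢ lt)) ∷ All.tabulate⁺ (play-wait d)
    answers-All d (x ∷ u) (a ∷ c) p lt =
      play-play (a ∷ c) d (inj₂ p , ≢-sym (ℕ.<⇒≢ lt)) ∷
      answers-All d u c (⊑-tail p) (≤-trans (s≤s (ℕ.n≤1+n _)) lt)

    answers-AllPairs : ∀ u c → AllPairs (Join R) (answers u c)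
    answers-AllPairs []      []       = All.tabulate⁺ (play-wait []) ∷ AllPairs.tabulate⁺ {f = wait} wait-wait
    answers-AllPairs (x ∷ u) (p ∷ ps) =
      answers-All (p ∷ ps) u ps (⊑-step ⊑-refl) ≤-refl ∷ answers-AllPairs u ps

    trail : ∀ u → Clique u → List V
    trail u c = track (rights (answers u c))

    trail-clique : ∀ u c → Clique (trail u c)
    trail-clique u c = track-clique (rights-AllPairs (answers u c) (answers-AllPairs u c))

    -- A new answer in K_q leaves the trail as it was; any other is handed to the tracker, which
    -- only extends it.
    trail-extend : ∀ {x} u c d → trail u c ⊑ trail (x ∷ u) (d ∷ c)
    trail-extend {x} u c d with play (x ∷ u) (d ∷ c) | answers-AllPairs (x ∷ u) (d ∷ c)
    ... | inj₁ _ | _  = ⊑-refl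
    ... | inj₂ z | ps = track-extend (rights-AllPairs (inj₂ z ∷ answers u c) ps)

    -- Of the `length u + 2 + q` answers at most `q` lie in K_q, and the tracker loses at most one
    -- of the others.
    trail-longer : ∀ u c → length u < length (trail u c)
    trail-longer u c = s≤s⁻¹ (≤-trans rights-long (track-length (rights-AllPairs ys ps)))
      where
      ys = answers u c
      ps = answers-AllPairs u c
      open ℕ.≤-Reasoning
      rights-long : suc (suc (length u)) ≤ length (rights ys)
      rights-long = ℕ.+-cancelʳ-≤ q _ _ (begin
        suc (suc (length u)) + q                ≡⟨ answers-length u c ⟨
        length ys                               ≡⟨ length-lefts-rights ys ⟩
        length (lefts ys) + length (rights ys)  ≤⟨ ℕ.+-monoˡ-≤ _ (lefts-length≤ ys ps) ⟩
        q + length (rights ys)                  ≡⟨ ℕ.+-comm q _ ⟩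
        length (rights ys) + q                  ∎)

    -- The invariant of the infinite play: the moves so far form a suffix of the clique read off the
    -- answers to them.
    record State : Set where
      constructor state
      field
        {moves} : List V
        clique  : Clique moves
        follows : moves ⊑ trail moves clique

    open State

    reply : (s : State) → ∃ λ x → x ∷ moves s ⊑ trail (moves s) (clique s)
    reply (state {u} c p) = ⊑-extend p (trail-longer u c)

    reply-adjacent : ∀ s → All (proj₁ (reply s) ~_) (moves s)
    reply-adjacent s with d ∷ _ ← ⊑-AllPairs (proj₂ (reply s)) (trail-clique (moves s) (clique s)) = d

    advance : State → State
    advance s = state (reply-adjacent s ∷ clique s)
      -- The extended moves are a suffix of the old trail, which is a suffix of the new one.
      (⊑-trans (proj₂ (reply s)) (trail-extend (moves s) (clique s) (reply-adjacent s)))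

    states : ℕ → State
    states zero    = state [] ([]⊑ _)
    states (suc n) = advance (states n)

    vertex : ℕ → V
    vertex n = proj₁ (reply (states n))

    vertex-∈ : ∀ {i j} → i ≤ j → vertex i ∈ moves (states (suc j))
    vertex-∈ {j = j} i≤j with ℕ.m≤n⇒m<n∨m≡n i≤j
    ... | inj₂ refl        = here refl
    ... | inj₁ (s≤s i≤j-1) = there (vertex-∈ i≤j-1)

    vertex-~ : ∀ {i j} → i < j → vertex j ~ vertex i
    vertex-~ {j = suc j} i<j = All.lookup (reply-adjacent (states (suc j))) (vertex-∈ (s≤s⁻¹ i<j))

    vertex-hom : ∀ {i j} → i ≢ j → vertex i ~ vertex j
    vertex-hom {i} {j} i≢j with ℕ.<-cmp i j
    ... | tri< i<j _ _ = ~-sym (vertex-~ i<j)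
    ... | tri≈ _ i≡j _ = contradiction i≡j i≢j
    ... | tri> _ _ j<i = vertex-~ j<i

    infiniteClique : ContainsSubgraph G Kω
    infiniteClique = vertex , injective , vertex-hom
      where
      injective : ∀ {i j} → vertex i ≡ vertex j → i ≡ j
      injective {i} {j} eq with i ℕ.≟ j
      ... | yes i≡j = i≡j
      ... | no  i≢j = contradiction (vertex-hom i≢j) (~-irrefl eq)

-- Coding lists of naturals

-- This is 2^n (2a + 1); it is never 0, which leaves 0 free to encode the empty list.
pair : ℕ → ℕ → ℕ
pair zero    a = suc (2 * a)
pair (suc n) a = 2 * pair n a

pair-injective : ∀ m n {a b} → pair m a ≡ pair n b → m ≡ n × a ≡ b
pair-injective zero    zero    eq = refl , ℕ.*-cancelˡ-≡ _ _ 2 (ℕ.suc-injective eq)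
pair-injective zero    (suc n) {a} {b} eq = contradiction (sym eq) (ℕ.even≢odd (pair n b) a)
pair-injective (suc m) zero    {a} {b} eq = contradiction eq (ℕ.even≢odd (pair m a) b)
pair-injective (suc m) (suc n) eq =
  let p , q = pair-injective m n (ℕ.*-cancelˡ-≡ _ _ 2 eq) in cong suc p , q

pair≢0 : ∀ n {a} → pair n a ≢ 0
pair≢0 (suc n) eq = pair≢0 n (ℕ.*-cancelˡ-≡ _ _ 2 eq)

encode : List ℕ → ℕ
encode = List.foldr pair 0

encode-injective : ∀ {xs ys} → encode xs ≡ encode ys → xs ≡ ys
encode-injective {[]}     {[]}     eq = refl
encode-injective {[]}     {y ∷ ys} eq = contradiction (sym eq) (pair≢0 y)
encode-injective {x ∷ xs} {[]}     eq = contradiction eq (pair≢0 x)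
encode-injective {x ∷ xs} {y ∷ ys} eq with pair-injective x y eq
... | refl , eq′ = cong (x ∷_) (encode-injective eq′)

-- The ray and its attachment to the finite rigid graph

-- `(k , j)` is the ray vertex with number 3k + j. The residue `j` selects its hooks, and the block
-- `k` can identify a vertex outside the ray.
Position : Set
Position = ℕ × Fin 3

rotate : Fin 3 → Fin 3
rotate 0F = 1F
rotate 1F = 2F
rotate 2F = 0F

next : Position → Position
next (k , 0F) = k , 1F
next (k , 1F) = k , 2F
next (k , 2F) = suc k , 0F

next-injective : ∀ p p′ → next p ≡ next p′ → p ≡ p′
next-injective (_ , 0F) (_ , 0F) refl = refl
next-injective (_ , 0F) (_ , 1F) ()
next-injective (_ , 0F) (_ , 2F) ()
next-injective (_ , 1F) (_ , 0F) ()
next-injective (_ , 1F) (_ , 1F) refl = refl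
next-injective (_ , 1F) (_ , 2F) ()
next-injective (_ , 2F) (_ , 0F) ()
next-injective (_ , 2F) (_ , 1F) ()
next-injective (_ , 2F) (_ , 2F) refl = refl

next-slot : ∀ p → proj₂ (next p) ≡ rotate (proj₂ p)
next-slot (_ , 0F) = refl
next-slot (_ , 1F) = refl
next-slot (_ , 2F) = refl

rotate-≢ : ∀ j → j ≢ rotate j
rotate-≢ = from-yes (all? λ j → ¬? (j ≟ rotate j))

next-≢ : ∀ p → p ≢ next p
next-≢ p eq = rotate-≢ _ (trans (cong proj₂ eq) (next-slot p))

next-induction : (P : Position → Set) → P (0 , 0F) → (∀ p → P p → P (next p)) → ∀ p → P p
next-induction P base step = λ where
    (k , 0F) → at₀ k
    (k , 1F) → step _ (at₀ k)
    (k , 2F) → step _ (step _ (at₀ k))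
  where
  at₀ : ∀ k → P (k , 0F)
  at₀ zero    = base
  at₀ (suc k) = step _ (step _ (step _ (at₀ k)))

-- Found by computer search, so as to satisfy the lemmas decided below.
hook hook′ : Fin 3 → Fin 8
hook 0F = 0F
hook 1F = 2F
hook 2F = 3F
hook′ 0F = 1F
hook′ 1F = 4F
hook′ 2F = 7F

-- An extra neighbour for the first ray vertex, which has no predecessor to be recognised by.
start : Fin 8
start = 5F

Hooked : Fin 8 → Fin 3 → Set
Hooked a j = a ≡ hook j ⊎ a ≡ hook′ j

hooked? : ∀ a j → Dec (Hooked a j)
hooked? a j = a ≟ hook j ⊎-dec a ≟ hook′ j

Attached : Fin 8 → Position → Set
Attached a p = Hooked a (proj₂ p) ⊎ (a ≡ start × p ≡ (0 , 0F))

-- Forgetting that `start` serves only the first position leaves a condition on the residue alone,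
-- which a finite check can decide.
attached-weaken : ∀ a p → Attached a p → Hooked a (proj₂ p) ⊎ a ≡ start
attached-weaken a p (inj₁ h)       = inj₁ h
attached-weaken a p (inj₂ (e , _)) = inj₂ e

weakly? : ∀ a j → Dec (Hooked a j ⊎ a ≡ start)
weakly? a j = hooked? a j ⊎-dec a ≟ start

hook≢hook′ : ∀ j → hook j ≢ hook′ j
hook≢hook′ = from-yes (all? λ j → ¬? (hook j ≟ hook′ j))

hooks-start-common : ∀ a → ¬ (Edge a (hook 0F) × Edge a (hook′ 0F) × Edge a start)
hooks-start-common = from-yes (all? λ a → ¬? (edge? a (hook 0F) ×-dec edge? a (hook′ 0F) ×-dec edge? a start))

start-not-hooked : ∀ j → ¬ Hooked start j
start-not-hooked = from-yes (all? λ j → ¬? (hooked? start j))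

-- Prevents a vertex of F from being mistaken for the successor of a ray vertex of residue `j`.
hooks-step-common : ∀ j a → Hooked a j ⊎ a ≡ start →
  ¬ (Edge a (hook (rotate j)) × Edge a (hook′ (rotate j)))
hooks-step-common = from-yes (all? λ j → all? λ a →
  weakly? a j →-dec ¬? (edge? a (hook (rotate j)) ×-dec edge? a (hook′ (rotate j))))

-- Distinguishes the two ray neighbours of a vertex: the predecessor, of residue `j`, lacks a hook
-- of the successor.
hook-not-back : ∀ j → ¬ (Hooked (hook (rotate (rotate j))) j ⊎ hook (rotate (rotate j)) ≡ start)
hook-not-back = from-yes (all? λ j → ¬? (weakly? (hook (rotate (rotate j))) j))

-- Keeps vertices of F from being common neighbours of ray vertices of residues 0 and 1, the pair
-- that pins a low vertex.
hooks-disjoint : ∀ a → Hooked a 0F ⊎ a ≡ start → ¬ Hooked a 1F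
hooks-disjoint = from-yes (all? λ a → weakly? a 0F →-dec ¬? (hooked? a 1F))

-- The rigid extension

module Construction (G : Graph) (countable : Countable G) where

  open Graph G renaming (Vertex to V)
  open Injection countable using () renaming (to to index; injective to index-injective)

  -- Vertices carry no evidence of being good, since adjacency proofs in G are
  -- not unique and would spoil countability; only good items get edges.
  data Item : Set where
    wait : ℕ → Item
    node : List V → Item

  Good : ℕ → Item → Set
  Good n (wait i) = i < n
  Good n (node u) = Clique G u

  Compatible : Rel Item 0ℓ
  Compatible (wait i) (wait j) = i ≢ j
  Compatible (node u) (node w) = Comparable u w
  Compatible _        _        = ⊤

  Compatible-sym : ∀ s t → Compatible s t → Compatible t s
  Compatible-sym (wait _) (wait _) p = ≢-sym p
  Compatible-sym (wait _) (node _) _ = tt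
  Compatible-sym (node _) (wait _) _ = tt
  Compatible-sym (node _) (node _) p = Comparable-sym p

  Compatible-irrefl : ∀ s → ¬ Compatible s s
  Compatible-irrefl (wait _) p       = p refl
  Compatible-irrefl (node _) (_ , p) = p refl

  -- `branch a n s` is the item `s` in the copy of K_n ∨ T whose root is `fix a`.
  data Low : Set where
    old    : V → Low
    branch : Fin 8 → ℕ → Item → Low

  lowCode : Low → List ℕ
  lowCode (old v)               = 0 ∷ index v ∷ []
  lowCode (branch a n (wait i)) = 1 ∷ toℕ a ∷ n ∷ i ∷ []
  lowCode (branch a n (node u)) = 2 ∷ toℕ a ∷ n ∷ List.map index u

  lowCode-injective : ∀ l m → lowCode l ≡ lowCode m → l ≡ m
  lowCode-injective (old v) (old w) eq
    with refl ← index-injective (proj₁ (∷-injective (proj₂ (∷-injective eq)))) = refl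
  lowCode-injective (old _) (branch _ _ (wait _)) ()
  lowCode-injective (old _) (branch _ _ (node _)) ()
  lowCode-injective (branch _ _ (wait _)) (old _) ()
  lowCode-injective (branch _ _ (node _)) (old _) ()
  lowCode-injective (branch _ _ (wait _)) (branch _ _ (node _)) ()
  lowCode-injective (branch _ _ (node _)) (branch _ _ (wait _)) ()
  lowCode-injective (branch a n (wait i)) (branch b m (wait j)) eq
    with eqₐ , eq′ ← ∷-injective (proj₂ (∷-injective eq))
    with refl ← toℕ-injective eqₐ | refl ← eq′ = refl
  lowCode-injective (branch a n (node u)) (branch b m (node w)) eq
    with eqₐ , eq′ ← ∷-injective (proj₂ (∷-injective eq))
    with refl , eqᵤ ← ∷-injective eq′
    with refl ← toℕ-injective eqₐ | refl ← map-injective index-injective eqᵤ = refl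

  -- The block of the ray reserved for a low vertex; different low vertices get different blocks.
  pin : Low → ℕ
  pin = encode ∘ lowCode

  pin-injective : ∀ {l m} → pin l ≡ pin m → l ≡ m
  pin-injective eq = lowCode-injective _ _ (encode-injective eq)

  data Vertex′ : Set where
    fix : Fin 8 → Vertex′
    ray : Position → Vertex′
    low : Low → Vertex′

  vertexCode : Vertex′ → List ℕ
  vertexCode (fix a)       = 0 ∷ toℕ a ∷ []
  vertexCode (ray (k , j)) = 1 ∷ k ∷ toℕ j ∷ []
  vertexCode (low l)       = 2 ∷ lowCode l

  vertexCode-injective : ∀ x y → vertexCode x ≡ vertexCode y → x ≡ y
  vertexCode-injective (fix a) (fix b) eq =
    cong fix (toℕ-injective (proj₁ (∷-injective (proj₂ (∷-injective eq)))))
  vertexCode-injective (ray (k , i)) (ray (l , j)) eq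
    with refl , eq′ ← ∷-injective (proj₂ (∷-injective eq)) =
    cong (λ j → ray (k , j)) (toℕ-injective (proj₁ (∷-injective eq′)))
  vertexCode-injective (low l) (low m) eq =
    cong low (lowCode-injective l m (proj₂ (∷-injective eq)))

  RootOf : Fin 8 → Low → Set
  RootOf a (old _)        = ⊥
  RootOf a (branch b n s) = a ≡ b × Good n s

  Pinned : Position → Low → Set
  Pinned (k , j) l = k ≡ pin l × j ≢ 2F

  LowAdj : Rel Low 0ℓ
  LowAdj (old v)        (old w)        = v ~ w
  LowAdj (branch a n s) (branch b m t) = a ≡ b × n ≡ m × Good n s × Good m t × Compatible s t
  LowAdj _              _              = ⊥

  infix 4 _≈_

  _≈_ : Rel Vertex′ 0ℓ
  fix a ≈ fix b = Edge a b
  fix a ≈ ray p = Attached a p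
  fix a ≈ low l = RootOf a l
  ray p ≈ fix a = Attached a p
  ray p ≈ ray r = r ≡ next p ⊎ p ≡ next r
  ray p ≈ low l = Pinned p l
  low l ≈ fix a = RootOf a l
  low l ≈ ray p = Pinned p l
  low l ≈ low m = LowAdj l m

  LowAdj-sym : ∀ l m → LowAdj l m → LowAdj m l
  LowAdj-sym (old _)        (old _)        e                   = ~-sym e
  LowAdj-sym (branch _ _ s) (branch _ _ t) (p , q , g , h , c) =
    sym p , sym q , h , g , Compatible-sym s t c

  LowAdj-irrefl : ∀ l → ¬ LowAdj l l
  LowAdj-irrefl (old _)        e                   = ~-irrefl refl e
  LowAdj-irrefl (branch _ _ s) (_ , _ , _ , _ , c) = Compatible-irrefl s c

  ≈-sym : ∀ x y → x ≈ y → y ≈ x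
  ≈-sym (fix a) (fix b) e = Edge-sym a b e
  ≈-sym (fix _) (ray _) e = e
  ≈-sym (fix _) (low _) e = e
  ≈-sym (ray _) (fix _) e = e
  ≈-sym (ray _) (ray _) e = swap e
  ≈-sym (ray _) (low _) e = e
  ≈-sym (low _) (fix _) e = e
  ≈-sym (low _) (ray _) e = e
  ≈-sym (low l) (low m) e = LowAdj-sym l m e

  ≈-irrefl : ∀ x → ¬ (x ≈ x)
  ≈-irrefl (fix a) e        = Edge-irrefl a e
  ≈-irrefl (ray p) (inj₁ e) = next-≢ p e
  ≈-irrefl (ray p) (inj₂ e) = next-≢ p e
  ≈-irrefl (low l) e        = LowAdj-irrefl l e

  G′ : Graph
  G′ = record
    { Vertex   = Vertex′
    ; _~_      = _≈_
    ; ~-sym    = λ {x} {y} → ≈-sym x y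
    ; ~-irrefl = λ { {x} refl → ≈-irrefl x }
    }

  G′-countable : Countable G′
  G′-countable = mk↣ {to = encode ∘ vertexCode} λ eq → vertexCode-injective _ _ (encode-injective eq)

  G′-contains : ContainsInduced G′ G
  G′-contains = low ∘ old , (λ { refl → refl }) , λ _ _ → mk⇔ (λ e → e) (λ e → e)

  -- Vertices recognised as unique common neighbours

  RootOf-unique : ∀ {a b} l → RootOf a l → RootOf b l → a ≡ b
  RootOf-unique (branch _ _ _) (p , _) (q , _) = trans p (sym q)

  ray-first : ∀ x → x ≈ fix (hook 0F) → x ≈ fix (hook′ 0F) → x ≈ fix start → x ≡ ray (0 , 0F)
  ray-first (fix a) p q r              = contradiction (p , q , r) (hooks-start-common a)
  ray-first (ray (k , j)) p q (inj₁ r) = contradiction r (start-not-hooked j)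
  ray-first (ray _) p q (inj₂ (_ , r)) = cong ray r
  ray-first (low l) p q r              = contradiction (RootOf-unique l p q) (hook≢hook′ 0F)

  -- Vertices of F and the predecessor of `p` fail by the choice of hooks, and a low vertex has at
  -- most one neighbour in F.
  ray-next : ∀ p x → let j = rotate (proj₂ p) in
    x ≈ ray p → x ≈ fix (hook j) → x ≈ fix (hook′ j) → x ≡ ray (next p)
  ray-next p (fix a) e q r = contradiction (q , r) (hooks-step-common _ a (attached-weaken a p e))
  ray-next p (ray t) (inj₂ e) q r = cong ray e
  -- Here `p` is `next t`, so the hooks demanded of `t` are those two residues further on.
  ray-next p (ray t) (inj₁ refl) q r = contradiction
    (attached-weaken _ t (subst (λ j → Attached (hook (rotate j)) t) (next-slot t) q))
    (hook-not-back (proj₂ t))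
  ray-next p (low l) e q r = contradiction (RootOf-unique l q r) (hook≢hook′ _)

  ray-triangle-free : ∀ k t → ray t ≈ ray (k , 0F) → ¬ (ray t ≈ ray (k , 1F))
  ray-triangle-free k (_ , 0F) (inj₁ ())   _
  ray-triangle-free k (_ , 1F) (inj₁ ())   _
  ray-triangle-free k (_ , 2F) (inj₁ refl) (inj₁ ())
  ray-triangle-free k (_ , 2F) (inj₁ refl) (inj₂ ())
  ray-triangle-free k _        (inj₂ refl) (inj₁ ())
  ray-triangle-free k _        (inj₂ refl) (inj₂ ())

  low-pinned : ∀ l x → x ≈ ray (pin l , 0F) → x ≈ ray (pin l , 1F) → x ≡ low l
  low-pinned l (fix a) p (inj₁ q) = contradiction q (hooks-disjoint a (attached-weaken a _ p))
  low-pinned l (ray t) p q        = contradiction q (ray-triangle-free _ t p)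
  low-pinned l (low m) (p , _) q = cong low (pin-injective (sym p))

  -- A homomorphism from the neighbourhood of x to the join of a finite complete
  -- graph with Z; it prevents x from being the image of a root of branches.
  record Escape (x : Vertex′) : Set₁ where
    field
      {slots}  : ℕ
      {Z}      : Set
      {R}      : Rel Z 0ℓ
      tracker  : Tracker G Z R
      view     : ∀ y → x ≈ y → Fin slots ⊎ Z
      view-hom : ∀ y z d e → y ≈ z → Join R (view y d) (view z e)

  -- A ray vertex has at most eight neighbours in F, two on the ray and one low one, so its
  -- neighbourhood injects into K_11.
  escape-ray : ∀ p → Escape (ray p)
  escape-ray p = record
    { slots    = 8 + 3
    ; tracker  = trackVertices G
    ; view     = λ y e → inj₁ (slot y e)
    ; view-hom = λ y z d e y≈z eq → ≈-irrefl z (subst (_≈ z) (slot-injective y z d e eq) y≈z)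
    }
    where
    slot : ∀ y → ray p ≈ y → Fin (8 + 3)
    slot (fix a) _        = a ↑ˡ 3
    slot (ray _) (inj₁ _) = 8 ↑ʳ 0F
    slot (ray _) (inj₂ _) = 8 ↑ʳ 1F
    slot (low _) _        = 8 ↑ʳ 2F

    slot-injective : ∀ y z d e → slot y d ≡ slot z e → y ≡ z
    slot-injective (fix a) (fix b) _ _ eq = cong fix (↑ˡ-injective 3 a b eq)
    slot-injective (fix a) (ray _) _ (inj₁ _) eq = contradiction eq (↑ˡ≢↑ʳ a _)
    slot-injective (fix a) (ray _) _ (inj₂ _) eq = contradiction eq (↑ˡ≢↑ʳ a _)
    slot-injective (fix a) (low _) _ _ eq = contradiction eq (↑ˡ≢↑ʳ a _)
    slot-injective (ray _) (fix b) (inj₁ _) _ eq = contradiction (sym eq) (↑ˡ≢↑ʳ b _)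
    slot-injective (ray _) (fix b) (inj₂ _) _ eq = contradiction (sym eq) (↑ˡ≢↑ʳ b _)
    slot-injective (low _) (fix b) _ _ eq = contradiction (sym eq) (↑ˡ≢↑ʳ b _)
    slot-injective (ray _) (ray _) (inj₁ d) (inj₁ e) _ = cong ray (trans d (sym e))
    slot-injective (ray r) (ray s) (inj₂ d) (inj₂ e) _ = cong ray (next-injective r s (trans (sym d) e))
    slot-injective (ray _) (ray _) (inj₁ _) (inj₂ _) ()
    slot-injective (ray _) (ray _) (inj₂ _) (inj₁ _) ()
    slot-injective (ray _) (low _) (inj₁ _) _ ()
    slot-injective (ray _) (low _) (inj₂ _) _ ()
    slot-injective (low _) (ray _) _ (inj₁ _) ()
    slot-injective (low _) (ray _) _ (inj₂ _) ()
    slot-injective (low l) (low m) (d , _) (e , _) _ = cong low (pin-injective (trans (sym d) e))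

  pinned-slot : ∀ {p r l} → Pinned p l → Pinned r l → proj₂ p ≡ proj₂ r → p ≡ r
  pinned-slot (refl , _) (refl , _) refl = refl

  escape-old : ∀ v → Escape (low (old v))
  escape-old v = record { tracker = trackVertices G ; view = view ; view-hom = view-hom }
    where
    -- Ray neighbours all lie in one block, so their residues tell them apart.
    view : ∀ y → low (old v) ≈ y → Fin 3 ⊎ V
    view (ray (_ , j)) _  = inj₁ j
    view (low (old w)) _  = inj₂ w

    view-hom : ∀ y z d e → y ≈ z → Join _~_ (view y d) (view z e)
    view-hom (ray p)       (ray r)       d e y≈z eq =
      ≈-irrefl (ray r) (subst (λ t → ray t ≈ ray r) (pinned-slot {l = old v} d e eq) y≈z)
    view-hom (ray _)       (low (old _)) d e y≈z = tt
    view-hom (low (old _)) (ray _)       d e y≈z = tt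
    view-hom (low (old _)) (low (old _)) d e y≈z = y≈z

  escape-branch : ∀ a n s → Escape (low (branch a n s))
  escape-branch a n s = record { tracker = trackLists G ; view = view ; view-hom = view-hom }
    where
    -- One slot is for the root, three are for ray residues and `n` for the waiting vertices; for a
    -- node, the edge itself supplies the proof that it is a clique.
    view : ∀ y → low (branch a n s) ≈ y → Fin (suc (3 + n)) ⊎ CliqueList G
    view (fix _) _ = inj₁ zero
    view (ray (_ , j)) _ = inj₁ (suc (j ↑ˡ n))
    view (low (branch _ _ (wait _))) (_ , refl , _ , i<n , _) = inj₁ (suc (3 ↑ʳ fromℕ< i<n))
    view (low (branch _ _ (node u))) (_ , _ , _ , clique , _) = inj₂ (u , clique)

    view-hom : ∀ y z d e → y ≈ z → Join (_≬_ G) (view y d) (view z e)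
    view-hom (fix b) (fix c) (refl , _) (refl , _) y≈z _ = Edge-irrefl b y≈z
    view-hom (ray p) (ray r) d e y≈z eq =
      ≈-irrefl (ray r) (subst (λ t → ray t ≈ ray r)
        (pinned-slot {l = branch a n s} d e (↑ˡ-injective n _ _ (suc-injective eq))) y≈z)
    view-hom (ray (_ , j)) (low (branch _ _ (wait _))) d (_ , refl , _) y≈z eq =
      ↑ˡ≢↑ʳ j _ (suc-injective eq)
    view-hom (low (branch _ _ (wait _))) (ray (_ , j)) (_ , refl , _) e y≈z eq =
      ↑ˡ≢↑ʳ j _ (suc-injective (sym eq))
    view-hom (low (branch _ _ (wait _))) (low (branch _ _ (wait _)))
      (_ , refl , _ , i<n , _) (_ , refl , _ , j<n , _) (_ , _ , _ , _ , i≢j) eq =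
      i≢j (fromℕ<-injective _ _ i<n j<n (↑ʳ-injective 3 _ _ (suc-injective eq)))
    view-hom (low (branch _ _ (node _))) (low (branch _ _ (node _))) d e (_ , _ , _ , _ , c) = c
    view-hom (low (branch _ _ (node _))) (low (branch _ _ (wait _))) d (_ , refl , _) y≈z = tt
    view-hom (low (branch _ _ (wait _))) (low (branch _ _ (node _))) (_ , refl , _) e y≈z = tt
    view-hom (low (branch _ _ (wait _))) (fix _) (_ , refl , _) e y≈z ()
    view-hom (fix _) (low (branch _ _ (wait _))) d (_ , refl , _) y≈z ()
    view-hom (fix _) (ray _) d e y≈z ()
    view-hom (ray _) (fix _) d e y≈z ()
    view-hom (fix _) (low (branch _ _ (node _))) d e y≈z = tt
    view-hom (low (branch _ _ (node _))) (fix _) d e y≈z = tt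
    view-hom (ray _) (low (branch _ _ (node _))) d e y≈z = tt
    view-hom (low (branch _ _ (node _))) (ray _) d e y≈z = tt

  -- Endomorphisms of the extension

  module _ (f : Vertex′ → Vertex′) (hom : IsHomomorphism G′ G′ f) where

    escape⇒Kω : ∀ a → Escape (f (fix a)) → ContainsSubgraph G Kω
    escape⇒Kω a escape = CopyCat.infiniteClique G tracker
      (λ i → image (wait (toℕ i)) (toℕ<n i))
      (λ u c → image (node u) c)
      (λ {i} {j} i≢j → image-hom _ _ (toℕ<n i) (toℕ<n j) (i≢j ∘ toℕ-injective))
      (λ c i → image-hom _ _ c (toℕ<n i) tt)
      (λ c d r → image-hom _ _ d c r)
      where
      open Escape escape
      -- Among the copies at the root `a`, the one whose waiting vertices outnumber the slots by one
      -- is used; its good items are neighbours of the root, so their images can be viewed.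
      image : ∀ s → Good (suc slots) s → Fin slots ⊎ Z
      image s g = view (f (low (branch a (suc slots) s))) (hom (refl , g))

      image-hom : ∀ s t g h → Compatible s t → Join R (image s g) (image t h)
      image-hom s t g h c = view-hom _ _ _ _ (hom (refl , refl , g , h , c))

    fix-closed : ¬ ContainsSubgraph G Kω → ∀ a → ∃ λ b → f (fix a) ≡ fix b
    fix-closed noKω a with f (fix a) in eq
    ... | fix b = b , refl
    ... | ray p = contradiction (escape⇒Kω a (subst Escape (sym eq) (escape-ray p))) noKω
    ... | low (old v) = contradiction (escape⇒Kω a (subst Escape (sym eq) (escape-old v))) noKω
    ... | low (branch b n s) = contradiction (escape⇒Kω a (subst Escape (sym eq) (escape-branch b n s))) noKω

    -- Hence `f` fixes any vertex that is the only common neighbour of some fixed vertices.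
    ≈-image : ∀ {x y} → f y ≡ y → x ≈ y → f x ≈ y
    ≈-image {x} fy≡y x≈y = subst (f x ≈_) fy≡y (hom x≈y)

    module _ (fix-fixed : ∀ a → f (fix a) ≡ fix a) where

      ray-fixed : ∀ p → f (ray p) ≡ ray p
      ray-fixed = next-induction (λ p → f (ray p) ≡ ray p)
        (ray-first _ (≈-image (fix-fixed _) (inj₁ (inj₁ refl)))
          (≈-image (fix-fixed _) (inj₁ (inj₂ refl)))
          (≈-image (fix-fixed _) (inj₂ (refl , refl))))
        λ p fixed → ray-next p _ (≈-image fixed (inj₂ refl))
          (≈-image (fix-fixed _) (inj₁ (inj₁ (cong hook (sym (next-slot p))))))
          (≈-image (fix-fixed _) (inj₁ (inj₂ (cong hook′ (sym (next-slot p))))))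

      all-fixed : ∀ x → f x ≡ x
      all-fixed (fix a) = fix-fixed a
      all-fixed (ray p) = ray-fixed p
      all-fixed (low l) = low-pinned l _
        (≈-image (ray-fixed _) (refl , λ ())) (≈-image (ray-fixed _) (refl , λ ()))

  G′-rigid : ¬ ContainsSubgraph G Kω → Rigid G′
  G′-rigid noKω f hom = all-fixed f hom λ a →
    trans (proj₂ (closed a)) (cong fix (Edge-rigid (proj₁ ∘ closed) edges a))
    where
    closed = fix-closed f hom noKω
    edges : ∀ a b → Edge a b → Edge (proj₁ (closed a)) (proj₁ (closed b))
    edges a b e = subst₂ _≈_ (proj₂ (closed a)) (proj₂ (closed b)) (hom e)

theorem4 : (G : Graph) → Countable G → ¬ ContainsSubgraph G Kω →
    Σ Graph λ G′ → Countable G′ × Rigid G′ × ContainsInduced G′ G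
theorem4 G countable noKω = G′ , G′-countable , G′-rigid noKω , G′-contains
  where open Construction G countable
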